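{- Let $k\ge 2$ and $\sigma\in\{+,-\}^k$ with $\sigma\neq -^k$ (i.e. not all entries equal to $-$). Then for every $n\ge 1$ and every permutation $\pi\in\mathcal S_n$, we have $\pi\in\mathcal P(\Sigma_\sigma)$ if and only if $\hat\pi\in\mathcal C^\sigma$.
   Context: Fix $k\ge2$ and $\sigma=\sigma_0\sigma_1\dots\sigma_{k-1}\in\{+,-\}^k$; let $T^-_\sigma=\{t:\sigma_t=-\}$. Let $\mathcal W_k$ be the set of infinite words $s=s_1s_2\dots$ over $\{0,1,\dots,k-1\}$, and write $s_{[i,\infty)}=s_is_{i+1}\dots$. Define a linear order $\prec_\sigma$ on $\mathcal W_k$: for $s\neq t$, let $j$ be the first index with $s_j\ne t_j$ and $c=|\{i<j: s_i\in T^-_\sigma\}|$; then $s\prec_\sigma t$ iff either $c$ is even and $s_j<t_j$, or $c$ is odd and $s_j>t_j$. The signed shift $\Sigma_\sigma:\mathcal W_k\to\mathcal W_k$ is $\Sigma_\sigma(s_1s_2s_3\dots)=s_2s_3\dots$. A finite word is primitive if it is not a concatenation of two or more copies of a shorter word; $q^\infty$ denotes the infinite periodic word $qqq\dots$. Let $\mathcal W_{k,n}$ be the set of words $(s_1\dots s_n)^\infty$ with $s_1\dots s_n$ primitive (the $n$-periodic points of $\Sigma_\sigma$). For $s\in\mathcal W_{k,n}$, the periodic pattern $\Pi_\sigma(s)\in\mathcal S_n$ is the permutation with $\Pi_\sigma(s)_i<\Pi_\sigma(s)_j$ iff $s_{[i,\infty)}\prec_\sigma s_{[j,\infty)}$ ($1\le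 i,j\le n$). Let $\mathcal P_n(\Sigma_\sigma)=\{\Pi_\sigma(s):s\in\mathcal W_{k,n}\}$ and $\mathcal P(\Sigma_\sigma)=\bigcup_{n\ge1}\mathcal P_n(\Sigma_\sigma)$. For $\pi=\pi_1\dots\pi_n\in\mathcal S_n$ (one-line notation), $\hat\pi$ is the cyclic permutation with cycle notation $(\pi_1,\pi_2,\dots,\pi_n)$, i.e. $\hat\pi_{\pi_i}=\pi_{i+1}$ with $\pi_{n+1}=\pi_1$. A $\sigma$-segmentation of $\tau\in\mathcal S_n$ is a sequence $0=e_0\le e_1\le\dots\le e_k=n$ such that for each $0\le t<k$ the segment $\tau_{e_t+1}\dots\tau_{e_{t+1}}$ is increasing if $\sigma_t=+$ and decreasing if $\sigma_t=-$. $\mathcal S^\sigma$ is the set of permutations (of any length) admitting a $\sigma$-segmentation, and $\mathcal C^\sigma$ is the set of cyclic permutations (permutations consisting of a single cycle) in $\mathcal S^\sigma$. -}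

module Defs where

open import Data.Nat as ℕ using (ℕ; zero; suc; _+_; _%_)
open import Data.Nat.Divisibility using (_∣_)
open import Data.Fin as F using (Fin; toℕ; fromℕ<)
open import Data.Nat.DivMod using (m%n<n)
open import Data.Fin.Permutation using (Permutation′; _⟨$⟩ʳ_; _⟨$⟩ˡ_)
open import Data.Product using (Σ; ∃; _×_; _,_)
open import Data.Sum using (_⊎_)
open import Data.Empty using (⊥)
open import Relation.Nullary using (¬_)
open import Relation.Binary.PropositionalEquality using (_≡_)
open import Function.Definitions using (Bijective)
open import Function.Bundles using (_⇔_)

data Sign : Set where
  plus minus : Sign

-- Infinite words over the alphabet {0,…,k-1}; positions indexed from 0
-- (position m here is s_{m+1} in the paper).
Word : ℕ → Set
Word k = ℕ → Fin k

shift : ∀ {k} → Word k → ℕ → Word k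
shift s i m = s (i + m)

countMinus : ∀ {k} → (Fin k → Sign) → Word k → ℕ → ℕ
countMinus σ s zero = zero
countMinus σ s (suc j) with σ (s j)
... | minus = suc (countMinus σ s j)
... | plus  = countMinus σ s j

Prec : ∀ {k} → (Fin k → Sign) → Word k → Word k → Set
Prec σ s t = ∃ λ j → (∀ i → i ℕ.< j → s i ≡ t i)
  × (((countMinus σ s j % 2 ≡ 0) × (s j F.< t j))
    ⊎ ((countMinus σ s j % 2 ≡ 1) × (t j F.< s j)))

-- s ∈ 𝒲_{k,n}: s = (s_1 … s_n)^∞ with s_1 … s_n primitive.
-- Primitive: not of the form q^m (m ≥ 2) with |q| = d, i.e. there is no
-- proper divisor length d (0 < d < n, d ∣ n) with s_1…s_n d-periodic.
Primitive : ∀ {k} → ℕ → Word k → Set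
Primitive n s = ¬ (∃ λ d → (0 ℕ.< d) × (d ℕ.< n) × (d ∣ n)
  × (∀ i → i + d ℕ.< n → s (i + d) ≡ s i))

InW : ∀ {k} → ℕ → Word k → Set
InW n s = (∀ i → s (i + n) ≡ s i) × Primitive n s

IsPattern : ∀ {k n} → (Fin k → Sign) → Word k → Permutation′ n → Set
IsPattern {n = n} σ s π = ∀ (i j : Fin n) →
  ((π ⟨$⟩ʳ i) F.< (π ⟨$⟩ʳ j)) ⇔ Prec σ (shift s (toℕ i)) (shift s (toℕ j))

-- π ∈ 𝒫_n(Σ_σ) (for π ∈ S_n this is the same as π ∈ 𝒫(Σ_σ)).
InP : ∀ {k n} → (Fin k → Sign) → Permutation′ n → Set
InP {k} {n} σ π = ∃ λ (s : Word k) → InW n s × IsPattern σ s π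

nextIdx : ∀ {n} → Fin n → Fin n
nextIdx {suc m} i = fromℕ< (m%n<n (suc (toℕ i)) (suc m))

hat : ∀ {n} → Permutation′ n → Fin n → Fin n
hat π j = π ⟨$⟩ʳ nextIdx (π ⟨$⟩ˡ j)

iter : ∀ {n} → (Fin n → Fin n) → ℕ → Fin n → Fin n
iter f zero i = i
iter f (suc m) i = f (iter f m i)

SingleCycle : ∀ {n} → (Fin n → Fin n) → Set
SingleCycle {n} f = ∀ (i j : Fin n) → ∃ λ m → iter f m i ≡ j

Monotone : ∀ {n} → Sign → (Fin n → Fin n) → ℕ → ℕ → Set
Monotone {n} plus τ a b = ∀ (p q : Fin n) → a ℕ.≤ toℕ p → toℕ p ℕ.< toℕ q → toℕ q ℕ.< b → τ p F.< τ q
Monotone {n} minus τ a b = ∀ (p q : Fin n) → a ℕ.≤ toℕ p → toℕ p ℕ.< toℕ q → toℕ q ℕ.< b → τ q F.< τ p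

IsSegmentation : ∀ {k n} → (Fin k → Sign) → (Fin n → Fin n) → (Fin (suc k) → ℕ) → Set
IsSegmentation {k} {n} σ τ e =
  (e F.zero ≡ 0) × (e (F.fromℕ k) ≡ n)
  × (∀ (t : Fin k) → e (F.inject₁ t) ℕ.≤ e (F.suc t))
  × (∀ (t : Fin k) → Monotone (σ t) τ (e (F.inject₁ t)) (e (F.suc t)))

InS : ∀ {k n} → (Fin k → Sign) → (Fin n → Fin n) → Set
InS {k} σ τ = ∃ λ (e : Fin (suc k) → ℕ) → IsSegmentation σ τ e

InC : ∀ {k n} → (Fin k → Sign) → (Fin n → Fin n) → Set
InC σ τ = Bijective _≡_ _≡_ τ × SingleCycle τ × InS σ τ

{-# OPTIONS --safe #-}
module Submission where

open import Defs
open import Data.Nat as ℕ using (ℕ; zero; suc; _+_; _*_; _∸_; _%_; _≤_; z≤n; s≤s)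
open import Data.Nat.DivMod using (m%n<n; m≡m%n+[m/n]*n; m<n⇒m%n≡m; m%n%n≡m%n; [m+n]%n≡m%n; [m+kn]%n≡m%n; %-distribˡ-+; m∣n⇒o%n%m≡o%m)
open import Data.Nat.Divisibility using (_∣_)
import Data.Nat.Properties as ℕₚ
open import Data.Fin as F using (Fin; zero; suc; toℕ; fromℕ<)
import Data.Fin.Properties as Fₚ
open import Data.Fin.Permutation using (Permutation′; _⟨$⟩ʳ_; _⟨$⟩ˡ_; inverseˡ; inverseʳ)
open import Data.Product using (∃; _×_; _,_; proj₁; proj₂)
open import Data.Sum using (_⊎_; inj₁; inj₂)
open import Function using (_∘_)
open import Function.Bundles using (_⇔_; mk⇔; Equivalence)
open import Function.Definitions using (Bijective)
open import Relation.Binary.Definitions using (tri<; tri≈; tri>)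
open import Relation.Binary.PropositionalEquality using (_≡_; _≢_; refl; sym; trans; cong; cong₂; subst; subst₂; module ≡-Reasoning)
open import Relation.Nullary using (¬_; Dec; yes; no; contradiction)
open import Relation.Nullary.Decidable using (_×-dec_; map′)
open import Relation.Unary using (Pred; Decidable)

-- A segmentation of τ = hat π labels each point x by the segment containing it. The labels read
-- along the orbit π₁, π₂, … form an n-periodic word s, and monotonicity of τ on the segments says
-- that π orders positions as ≺_σ orders the suffixes of s, whenever these suffixes differ. Hence a
-- word with pattern π gives a segmentation, and a segmentation gives a word with pattern π unless
-- s has a period d < n. In that case τ^(2d) preserves order among points with the same itinerary,
-- so it is the identity; thus n = 2d and the period contains an odd number of letters of sign −.
-- As some letter has sign +, there are two consecutive segments such that one is nonempty of sign −
-- and the other is empty or of sign +. One point can be moved across their border; this breaks the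
-- only possible period n / 2, so the new segmentation yields a primitive word.

-- Finite search

all-or-first-failure : ∀ {p} {P : Pred ℕ p} → Decidable P → ∀ N →
  (∀ i → i ℕ.< N → P i) ⊎ ∃ λ j → (∀ i → i ℕ.< j → P i) × ¬ P j
all-or-first-failure P? zero = inj₁ λ _ ()
all-or-first-failure P? (suc N) with all-or-first-failure P? N
... | inj₂ f = inj₂ f
... | inj₁ below with P? N
...   | no ¬PN = inj₂ (N , below , ¬PN)
...   | yes PN = inj₁ λ i i<1+N → case-< i (ℕₚ.m≤n⇒m<n∨m≡n (ℕₚ.≤-pred i<1+N))
  where
  case-< : ∀ i → i ℕ.< N ⊎ i ≡ N → _
  case-< i (inj₁ i<N)  = below i i<N
  case-< i (inj₂ refl) = PN

none-or-greatest : ∀ {n p} {P : Pred (Fin n) p} → Decidable P →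
  (∀ x → ¬ P x) ⊎ ∃ λ x → P x × (∀ y → P y → y F.≤ x)
none-or-greatest {zero} P? = inj₁ λ ()
none-or-greatest {suc n} P? with none-or-greatest (P? ∘ suc)
... | inj₂ (x , Px , greatest) = inj₂ (suc x , Px , λ { zero _ → z≤n ; (suc y) Py → s≤s (greatest y Py) })
... | inj₁ none with P? zero
...   | yes P0 = inj₂ (zero , P0 , λ { zero _ → z≤n ; (suc y) Py → contradiction Py (none y) })
...   | no ¬P0 = inj₁ λ { zero → ¬P0 ; (suc y) → none y }

none-or-least : ∀ {n p} {P : Pred (Fin n) p} → Decidable P →
  (∀ x → ¬ P x) ⊎ ∃ λ x → P x × (∀ y → P y → x F.≤ y)
none-or-least {zero} P? = inj₁ λ ()
none-or-least {suc n} P? with P? zero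
... | yes P0 = inj₂ (zero , P0 , λ _ _ → z≤n)
... | no ¬P0 with none-or-least (P? ∘ suc)
...   | inj₂ (x , Px , least) = inj₂ (suc x , Px , λ { zero P0 → contradiction P0 ¬P0 ; (suc y) Py → s≤s (least y Py) })
...   | inj₁ none = inj₁ λ { zero → ¬P0 ; (suc y) → none y }

-- A discrete intermediate value principle. With `P` meaning "of sign minus and nonempty" it finds
-- the two segments across whose border a point is moved.
adjacent-change : ∀ {n p} {P : Pred (Fin n) p} → Decidable P → ∀ {a b} → P a → ¬ P b →
  ∃ λ u → ∃ λ v → toℕ v ≡ suc (toℕ u) × ((P u × ¬ P v) ⊎ (¬ P u × P v))
adjacent-change {suc zero} P? {zero} {zero} Pa ¬Pb = contradiction Pa ¬Pb
adjacent-change {suc (suc n)} {P = P} P? {a} {b} Pa ¬Pb with P? zero | P? (suc zero)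
... | yes P0 | no ¬P1 = zero , suc zero , refl , inj₁ (P0 , ¬P1)
... | no ¬P0 | yes P1 = zero , suc zero , refl , inj₂ (¬P0 , P1)
... | yes P0 | yes P1 = lift-change b ¬Pb
  where
  lift-change : ∀ b → ¬ P b → _
  lift-change zero    ¬Pb = contradiction P0 ¬Pb
  lift-change (suc b) ¬Pb with adjacent-change {P = P ∘ suc} (P? ∘ suc) {zero} {b} P1 ¬Pb
  ... | u , v , v≡1+u , change = suc u , suc v , cong suc v≡1+u , change
... | no ¬P0 | no ¬P1 = lift-change a Pa
  where
  lift-change : ∀ a → P a → _
  lift-change zero    Pa = contradiction Pa ¬P0
  lift-change (suc a) Pa with adjacent-change {P = P ∘ suc} (P? ∘ suc) {a} {zero} Pa ¬P1
  ... | u , v , v≡1+u , change = suc u , suc v , cong suc v≡1+u , change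

-- Turns labels back into cut points: the points with label below `t` form an initial interval, and
-- its length `c` is the cut.
down-closed-threshold : ∀ n {p} {P : Pred (Fin n) p} → Decidable P → (∀ {x y} → x F.< y → P y → P x) →
  ∃ λ c → c ≤ n × (∀ x → toℕ x ℕ.< c → P x) × (∀ x → P x → toℕ x ℕ.< c)
down-closed-threshold zero P? closed = 0 , z≤n , (λ ()) , λ ()
down-closed-threshold (suc n) P? closed with P? zero
... | no ¬P0 = 0 , z≤n , (λ _ ()) ,
  λ { zero P0 → contradiction P0 ¬P0 ; (suc x) Px → contradiction (closed (s≤s z≤n) Px) ¬P0 }
... | yes P0 with down-closed-threshold n (P? ∘ suc) (λ x<y → closed (s≤s x<y))
...   | c , c≤n , below , above = suc c , s≤s c≤n ,
  (λ { zero _ → P0 ; (suc x) (s≤s x<c) → below x x<c }) ,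
  λ { zero _ → s≤s z≤n ; (suc x) Px → s≤s (above x Px) }

-- Locates the segment containing `x`. Taking the first cut point beyond `x` skips empty segments.
crossing : ∀ k (e : Fin (suc k) → ℕ) x → e zero ≤ x → x ℕ.< e (F.fromℕ k) →
  ∃ λ t → e (F.inject₁ t) ≤ x × x ℕ.< e (suc t)
crossing zero e x e₀≤x x<e₀ = contradiction x<e₀ (ℕₚ.≤⇒≯ e₀≤x)
crossing (suc k) e x e₀≤x x<eₖ with x ℕ.<? e (suc zero)
... | yes x<e₁ = zero , e₀≤x , x<e₁
... | no x≮e₁ with crossing k (e ∘ suc) x (ℕₚ.≮⇒≥ x≮e₁) x<eₖ
...   | t , e≤x , x<e = suc t , e≤x , x<e

nondecreasing : ∀ k (e : Fin (suc k) → ℕ) → (∀ t → e (F.inject₁ t) ≤ e (suc t)) →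
  ∀ {i j} → i F.≤ j → e i ≤ e j
nondecreasing k e step {zero} {zero} _ = ℕₚ.≤-refl
nondecreasing (suc k) e step {zero} {suc j} _ =
  ℕₚ.≤-trans (step zero) (nondecreasing k (e ∘ suc) (step ∘ suc) {zero} {j} z≤n)
nondecreasing (suc k) e step {suc i} {suc j} (s≤s i≤j) = nondecreasing k (e ∘ suc) (step ∘ suc) i≤j

-- Signs and signed order

infixl 7 _·_
_·_ : Sign → Sign → Sign
plus  · δ     = δ
minus · plus  = minus
minus · minus = plus

·-assoc : ∀ α β γ → (α · β) · γ ≡ α · (β · γ)
·-assoc plus  β     γ     = refl
·-assoc minus plus  γ     = refl
·-assoc minus minus plus  = refl
·-assoc minus minus minus = refl

·-identityʳ : ∀ α → α · plus ≡ α
·-identityʳ plus  = refl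
·-identityʳ minus = refl

·-self : ∀ α → α · α ≡ plus
·-self plus  = refl
·-self minus = refl

infix 4 _<[_]_ _≟ˢ_
-- Carrying the direction as a sign states increasing and decreasing segments uniformly, and
-- composing monotone maps multiplies the signs.
_<[_]_ : ∀ {n} → Fin n → Sign → Fin n → Set
x <[ plus  ] y = x F.< y
x <[ minus ] y = y F.< x

_≟ˢ_ : (α β : Sign) → Dec (α ≡ β)
plus  ≟ˢ plus  = yes refl
plus  ≟ˢ minus = no λ ()
minus ≟ˢ plus  = no λ ()
minus ≟ˢ minus = yes refl

≢minus⇒plus : ∀ {α} → α ≢ minus → α ≡ plus
≢minus⇒plus {plus}  _  = refl
≢minus⇒plus {minus} α≢ = contradiction refl α≢

<[]-irrefl : ∀ {n} ε {x : Fin n} → ¬ x <[ ε ] x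
<[]-irrefl plus  = ℕₚ.<-irrefl refl
<[]-irrefl minus = ℕₚ.<-irrefl refl

<[]-trans : ∀ {n} ε {x y z : Fin n} → x <[ ε ] y → y <[ ε ] z → x <[ ε ] z
<[]-trans plus  x<y y<z = ℕₚ.<-trans x<y y<z
<[]-trans minus y<x z<y = ℕₚ.<-trans z<y y<x

<[]-flip : ∀ {n} ε {x y : Fin n} → x <[ minus · ε ] y → y <[ ε ] x
<[]-flip plus  x<y = x<y
<[]-flip minus x<y = x<y

<[]-flip⁻ : ∀ {n} ε {x y : Fin n} → y <[ ε ] x → x <[ minus · ε ] y
<[]-flip⁻ plus  y<x = y<x
<[]-flip⁻ minus y<x = y<x

≢⇒<[] : ∀ {n} {x y : Fin n} → x ≢ y → ∃ λ ε → x <[ ε ] y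
≢⇒<[] {x = x} {y} x≢y with Fₚ.<-cmp x y
... | tri< x<y _ _ = plus , x<y
... | tri≈ _ x≡y _ = contradiction x≡y x≢y
... | tri> _ _ y<x = minus , y<x

≢⇒<[]-of-opposite-signs : ∀ {n} {α β} {x y : Fin n} → α ≢ β → x ≢ y → x <[ α ] y ⊎ x <[ β ] y
≢⇒<[]-of-opposite-signs {α = α} {β} α≢β x≢y with ≢⇒<[] x≢y
≢⇒<[]-of-opposite-signs {α = plus}  {plus}  α≢β x≢y | _ = contradiction refl α≢β
≢⇒<[]-of-opposite-signs {α = minus} {minus} α≢β x≢y | _ = contradiction refl α≢β
≢⇒<[]-of-opposite-signs {α = plus}  {minus} α≢β x≢y | plus  , x<y = inj₁ x<y
≢⇒<[]-of-opposite-signs {α = plus}  {minus} α≢β x≢y | minus , x<y = inj₂ x<y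
≢⇒<[]-of-opposite-signs {α = minus} {plus}  α≢β x≢y | plus  , x<y = inj₂ x<y
≢⇒<[]-of-opposite-signs {α = minus} {plus}  α≢β x≢y | minus , x<y = inj₁ x<y

Monotone⇒<[] : ∀ {n} ε {τ : Fin n → Fin n} {a b} → Monotone ε τ a b →
  ∀ p q → a ≤ toℕ p → p F.< q → toℕ q ℕ.< b → τ p <[ ε ] τ q
Monotone⇒<[] plus  mono = mono
Monotone⇒<[] minus mono = mono

<[]⇒Monotone : ∀ {n} ε {τ : Fin n → Fin n} {a b} →
  (∀ p q → a ≤ toℕ p → p F.< q → toℕ q ℕ.< b → τ p <[ ε ] τ q) → Monotone ε τ a b
<[]⇒Monotone plus  mono = mono
<[]⇒Monotone minus mono = mono

-- The order on words

module _ {k} (σ : Fin k → Sign) where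

  -- The parity of `countMinus` as a product of signs, which is multiplicative under concatenation.
  prefixSign : Word k → ℕ → Sign
  prefixSign s zero    = plus
  prefixSign s (suc j) = prefixSign s j · σ (s j)

  prefixSign-cong : ∀ {s t} j → (∀ i → i ℕ.< j → s i ≡ t i) → prefixSign s j ≡ prefixSign t j
  prefixSign-cong zero    s≗t = refl
  prefixSign-cong (suc j) s≗t =
    cong₂ (λ ε a → ε · σ a) (prefixSign-cong j λ i i<j → s≗t i (ℕₚ.m<n⇒m<1+n i<j)) (s≗t j ℕₚ.≤-refl)

  prefixSign-+ : ∀ s i j → prefixSign s (i + j) ≡ prefixSign s i · prefixSign (shift s i) j
  prefixSign-+ s i zero rewrite ℕₚ.+-identityʳ i = sym (·-identityʳ _)
  prefixSign-+ s i (suc j) rewrite ℕₚ.+-suc i j | prefixSign-+ s i j = ·-assoc (prefixSign s i) _ _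

  prefixSign-minus⇒minus : ∀ s j → prefixSign s j ≡ minus → ∃ λ i → σ (s i) ≡ minus
  prefixSign-minus⇒minus s (suc j) eq with σ (s j) in σsj
  ... | minus = j , σsj
  ... | plus  = prefixSign-minus⇒minus s j (trans (sym (·-identityʳ _)) eq)

  countMinus-parity : ∀ s j → (countMinus σ s j % 2 ≡ 0 × prefixSign s j ≡ plus)
                            ⊎ (countMinus σ s j % 2 ≡ 1 × prefixSign s j ≡ minus)
  countMinus-parity s zero = inj₁ (refl , refl)
  countMinus-parity s (suc j) with σ (s j) | countMinus-parity s j
  ... | plus  | inj₁ (c , eq) rewrite eq = inj₁ (c , refl)
  ... | plus  | inj₂ (c , eq) rewrite eq = inj₂ (c , refl)
  ... | minus | inj₁ (c , eq) rewrite eq = inj₂ (even⇒odd (countMinus σ s j) c , refl)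
    where
    even⇒odd : ∀ n → n % 2 ≡ 0 → suc n % 2 ≡ 1
    even⇒odd zero          _ = refl
    even⇒odd (suc (suc n)) c = even⇒odd n c
  ... | minus | inj₂ (c , eq) rewrite eq = inj₁ (odd⇒even (countMinus σ s j) c , refl)
    where
    odd⇒even : ∀ n → n % 2 ≡ 1 → suc n % 2 ≡ 0
    odd⇒even (suc zero)    _ = refl
    odd⇒even (suc (suc n)) c = odd⇒even n c

  SignedPrec : Word k → Word k → Set
  SignedPrec s t = ∃ λ j → (∀ i → i ℕ.< j → s i ≡ t i) × s j <[ prefixSign s j ] t j

  Prec⇒SignedPrec : ∀ {s t} → Prec σ s t → SignedPrec s t
  Prec⇒SignedPrec {s} (j , agree , diff) with countMinus-parity s j
  Prec⇒SignedPrec {s} {t} (j , agree , inj₁ (_ , lt)) | inj₁ (_ , eq) = j , agree , subst (s j <[_] t j) (sym eq) lt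
  Prec⇒SignedPrec {s} {t} (j , agree , inj₂ (_ , lt)) | inj₂ (_ , eq) = j , agree , subst (s j <[_] t j) (sym eq) lt
  Prec⇒SignedPrec (j , agree , inj₁ (c₀ , _)) | inj₂ (c₁ , _) = contradiction (trans (sym c₀) c₁) λ ()
  Prec⇒SignedPrec (j , agree , inj₂ (c₁ , _)) | inj₁ (c₀ , _) = contradiction (trans (sym c₀) c₁) λ ()

  SignedPrec⇒Prec : ∀ {s t} → SignedPrec s t → Prec σ s t
  SignedPrec⇒Prec {s} {t} (j , agree , lt) with countMinus-parity s j
  ... | inj₁ (c , eq) = j , agree , inj₁ (c , subst (s j <[_] t j) eq lt)
  ... | inj₂ (c , eq) = j , agree , inj₂ (c , subst (s j <[_] t j) eq lt)

  SignedPrec-resp-≗ : ∀ {s s′ t t′} → (∀ i → s i ≡ s′ i) → (∀ i → t i ≡ t′ i) → SignedPrec s t → SignedPrec s′ t′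
  SignedPrec-resp-≗ {s} {s′} {t} {t′} s≗s′ t≗t′ (j , agree , lt) =
    j , (λ i i<j → trans (sym (s≗s′ i)) (trans (agree i i<j) (t≗t′ i))) , lt′
    where
    lt′ : s′ j <[ prefixSign s′ j ] t′ j
    lt′ rewrite sym (prefixSign-cong {s} {s′} j λ i _ → s≗s′ i) | sym (s≗s′ j) | sym (t≗t′ j) = lt

  -- The empty prefix has sign plus, so first letters are never compared in reverse. This makes the
  -- labels read off a pattern weakly increasing.
  SignedPrec⇒head≤ : ∀ {s t} → SignedPrec s t → s 0 F.≤ t 0
  SignedPrec⇒head≤ (zero  , _     , lt) = ℕₚ.<⇒≤ lt
  SignedPrec⇒head≤ (suc j , agree , _)  = ℕₚ.≤-reflexive (cong toℕ (agree 0 (s≤s z≤n)))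

  SignedPrec-tail-plus : ∀ {s t} → s 0 ≡ t 0 → σ (s 0) ≡ plus → SignedPrec s t → SignedPrec (shift s 1) (shift t 1)
  SignedPrec-tail-plus s₀≡t₀ _ (zero , _ , lt) = contradiction lt (ℕₚ.<-irrefl (cong toℕ s₀≡t₀))
  SignedPrec-tail-plus {s} {t} _ σ≡ (suc j , agree , lt) =
    j , (λ i i<j → agree (suc i) (s≤s i<j)) ,
    subst (s (suc j) <[_] t (suc j)) (trans (prefixSign-+ s 1 j) (cong (_· prefixSign (shift s 1) j) σ≡)) lt

  -- The dropped letter contributed one factor `minus` to every later prefix sign, so the order of
  -- the tails is reversed.
  SignedPrec-tail-minus : ∀ {s t} → s 0 ≡ t 0 → σ (s 0) ≡ minus → SignedPrec s t → SignedPrec (shift t 1) (shift s 1)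
  SignedPrec-tail-minus s₀≡t₀ _ (zero , _ , lt) = contradiction lt (ℕₚ.<-irrefl (cong toℕ s₀≡t₀))
  SignedPrec-tail-minus {s} {t} _ σ≡ (suc j , agree , lt) =
    j , (λ i i<j → sym (agree (suc i) (s≤s i<j))) ,
    <[]-flip (prefixSign (shift t 1) j) (subst (s (suc j) <[_] t (suc j)) sign≡ lt)
    where
    -- The sign is taken along `t`, since the tail of `t` is now the left-hand word; the two tails
    -- agree before `j`.
    sign≡ : prefixSign s (suc j) ≡ minus · prefixSign (shift t 1) j
    sign≡ = trans (prefixSign-+ s 1 j)
      (cong₂ _·_ σ≡ (prefixSign-cong j λ i i<j → agree (suc i) (s≤s i<j)))

-- Segmentations as labellings of points

-- Unlike a list of cut points, a labelling can be read along an orbit and changed at a single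
-- point; an empty segment is a label that is not taken.
record Labelling {k n} (σ : Fin k → Sign) (τ : Fin n → Fin n) : Set where
  field
    label     : Fin n → Fin k
    weak-mono : ∀ {x y} → x F.< y → label x F.≤ label y
    fibrewise : ∀ {x y} → x F.< y → label x ≡ label y → τ x <[ σ (label x) ] τ y

module _ {k n} {σ : Fin k → Sign} {τ : Fin n → Fin n} where

  InS⇒Labelling : InS σ τ → Labelling σ τ
  InS⇒Labelling (e , e₀≡0 , eₖ≡n , e-step , e-mono) = record
    { label = proj₁ ∘ segment ; weak-mono = weak-mono ; fibrewise = fibrewise }
    where
    segment : ∀ (x : Fin n) → ∃ λ t → e (F.inject₁ t) ≤ toℕ x × toℕ x ℕ.< e (suc t)
    segment x = crossing k e (toℕ x) (subst (_≤ toℕ x) (sym e₀≡0) z≤n) (subst (toℕ x ℕ.<_) (sym eₖ≡n) (Fₚ.toℕ<n x))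
    weak-mono : ∀ {x y} → x F.< y → proj₁ (segment x) F.≤ proj₁ (segment y)
    weak-mono {x} {y} x<y with segment x | segment y
    ... | t , e≤x , _ | u , _ , y<e with toℕ t ℕ.≤? toℕ u
    ...   | yes t≤u = t≤u
    -- If u < t, the cut points would give y < e(u+1) ≤ e(t) ≤ x.
    ...   | no t≰u = contradiction x<y (ℕₚ.<⇒≯ (ℕₚ.<-≤-trans y<e (ℕₚ.≤-trans (nondecreasing k e e-step u<t) e≤x)))
      where
      u<t : suc u F.≤ F.inject₁ t
      u<t = subst (suc (toℕ u) ≤_) (sym (Fₚ.toℕ-inject₁ t)) (ℕₚ.≰⇒> t≰u)
    fibrewise : ∀ {x y} → x F.< y → proj₁ (segment x) ≡ proj₁ (segment y) → τ x <[ σ (proj₁ (segment x)) ] τ y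
    fibrewise {x} {y} x<y eq with segment x | segment y
    fibrewise {x} {y} x<y refl | t , e≤x , _ | .t , _ , y<e = Monotone⇒<[] (σ t) (e-mono t) x y e≤x x<y y<e

  -- The cut point `e t` is the number of points with label below `t`.
  Labelling⇒InS : Labelling σ τ → InS σ τ
  Labelling⇒InS L = e , e₀≡0 , eₖ≡n , e-step , e-mono
    where
    open Labelling L
    cut : ∀ (t : Fin (suc k)) → _
    cut t = down-closed-threshold n {P = λ x → toℕ (label x) ℕ.< toℕ t} (λ x → toℕ (label x) ℕ.<? toℕ t)
      (λ x<y → ℕₚ.≤-<-trans (weak-mono x<y))
    e : Fin (suc k) → ℕ
    e t = proj₁ (cut t)
    e≤n : ∀ t → e t ≤ n
    e≤n t = proj₁ (proj₂ (cut t))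
    <e⇒label< : ∀ t x → toℕ x ℕ.< e t → toℕ (label x) ℕ.< toℕ t
    <e⇒label< t = proj₁ (proj₂ (proj₂ (cut t)))
    label<⇒<e : ∀ t x → toℕ (label x) ℕ.< toℕ t → toℕ x ℕ.< e t
    label<⇒<e t = proj₂ (proj₂ (proj₂ (cut t)))
    at : ∀ {m} → m ℕ.< n → ∃ λ (x : Fin n) → toℕ x ≡ m
    at m<n = fromℕ< m<n , Fₚ.toℕ-fromℕ< m<n
    e-≤ : ∀ t c → (∀ x → toℕ (label x) ℕ.< toℕ t → toℕ x ℕ.< c) → e t ≤ c
    e-≤ t c bound with e t ℕ.≤? c
    ... | yes e≤c = e≤c
    -- The point in position `c` would have label below `t`, and `bound` would place it before
    -- itself.
    ... | no e≰c with at (ℕₚ.<-≤-trans (ℕₚ.≰⇒> e≰c) (e≤n t))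
    ...   | x , refl = contradiction (bound x (<e⇒label< t x (ℕₚ.≰⇒> e≰c))) (ℕₚ.<-irrefl refl)
    e₀≡0 : e zero ≡ 0
    e₀≡0 = ℕₚ.n≤0⇒n≡0 (e-≤ zero 0 λ _ ())
    eₖ≡n : e (F.fromℕ k) ≡ n
    eₖ≡n with e (F.fromℕ k) ℕ.<? n
    ... | no e≮n = ℕₚ.≤-antisym (e≤n _) (ℕₚ.≮⇒≥ e≮n)
    ... | yes e<n with at e<n
    ...   | x , x≡e = contradiction
      (label<⇒<e (F.fromℕ k) x (subst (toℕ (label x) ℕ.<_) (sym (Fₚ.toℕ-fromℕ k)) (Fₚ.toℕ<n (label x))))
      (ℕₚ.<-irrefl x≡e)
    e-step : ∀ t → e (F.inject₁ t) ≤ e (suc t)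
    e-step t = e-≤ (F.inject₁ t) (e (suc t)) λ x lt →
      label<⇒<e (suc t) x (ℕₚ.m<n⇒m<1+n (subst (toℕ (label x) ℕ.<_) (Fₚ.toℕ-inject₁ t) lt))
    e-mono : ∀ t → Monotone (σ t) τ (e (F.inject₁ t)) (e (suc t))
    e-mono t = <[]⇒Monotone (σ t) λ p q e≤p p<q q<e →
      -- Between the cuts of `t` and its successor, t ≤ label p ≤ label q ≤ t forces both labels to
      -- be `t`.
      let t≤p : t F.≤ label p
          t≤p = ℕₚ.≮⇒≥ λ p<t → ℕₚ.≤⇒≯ e≤p (label<⇒<e (F.inject₁ t) p (subst (toℕ (label p) ℕ.<_) (sym (Fₚ.toℕ-inject₁ t)) p<t))
          q≤t : label q F.≤ t
          q≤t = ℕₚ.≤-pred (<e⇒label< (suc t) q q<e)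
          p≤q = weak-mono p<q
          p≡t = Fₚ.toℕ-injective (ℕₚ.≤-antisym (ℕₚ.≤-trans p≤q q≤t) t≤p)
          q≡t = Fₚ.toℕ-injective (ℕₚ.≤-antisym q≤t (ℕₚ.≤-trans t≤p p≤q))
      in subst (λ u → τ p <[ σ u ] τ q) p≡t (fibrewise p<q (trans p≡t (sym q≡t)))

  open Labelling

  DifferByOne : Labelling σ τ → Labelling σ τ → Set
  DifferByOne L L′ = ∃ λ x → label L′ x ≢ label L x × (∀ y → y ≢ x → label L′ y ≡ label L y)

  -- Only comparisons involving `x` have to be checked; every other pair inherits its properties
  -- from `L`.
  relabel : (L : Labelling σ τ) (x : Fin n) (v : Fin k) → v ≢ label L x →
    (∀ {y} → y F.< x → label L y F.≤ v) → (∀ {y} → x F.< y → v F.≤ label L y) →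
    (∀ {y} → y F.< x → label L y ≡ v → τ y <[ σ v ] τ x) →
    (∀ {y} → x F.< y → label L y ≡ v → τ x <[ σ v ] τ y) →
    ∃ (DifferByOne L)
  relabel L x v v≢ below above fibre-below fibre-above =
    record { label = label′ ; weak-mono = mono′ ; fibrewise = fibre′ } , x , changed , unchanged
    where
    label′ : Fin n → Fin k
    label′ y with y F.≟ x
    ... | yes _ = v
    ... | no  _ = label L y
    changed : label′ x ≢ label L x
    changed with x F.≟ x
    ... | yes _  = v≢
    ... | no x≢x = contradiction refl x≢x
    unchanged : ∀ y → y ≢ x → label′ y ≡ label L y
    unchanged y y≢x with y F.≟ x
    ... | yes y≡x = contradiction y≡x y≢x
    ... | no _    = refl
    mono′ : ∀ {y z} → y F.< z → label′ y F.≤ label′ z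
    mono′ {y} {z} y<z with y F.≟ x | z F.≟ x
    ... | yes refl | yes refl = ℕₚ.≤-refl
    ... | yes refl | no _     = above y<z
    ... | no _     | yes refl = below y<z
    ... | no _     | no _     = weak-mono L y<z
    fibre′ : ∀ {y z} → y F.< z → label′ y ≡ label′ z → τ y <[ σ (label′ y) ] τ z
    fibre′ {y} {z} y<z eq with y F.≟ x | z F.≟ x
    ... | yes refl | yes refl = contradiction y<z (ℕₚ.<-irrefl refl)
    ... | yes refl | no _     = fibre-above y<z (sym eq)
    ... | no _     | yes refl = subst (λ u → τ y <[ σ u ] τ z) (sym eq) (fibre-below y<z eq)
    ... | no _     | no _     = fibrewise L y<z eq

  module _ (L : Labelling σ τ) {u v : Fin k} (v≡1+u : toℕ v ≡ suc (toℕ u)) where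

    private
      u<v : u F.< v
      u<v = ℕₚ.≤-reflexive (sym v≡1+u)

      v≢u : v ≢ u
      v≢u refl = ℕₚ.<-irrefl refl u<v

      label<⇒< : ∀ {x y} → label L x F.< label L y → x F.< y
      label<⇒< {x} {y} lt with Fₚ.<-cmp x y
      ... | tri< x<y _ _  = x<y
      ... | tri≈ _ refl _ = contradiction lt (ℕₚ.<-irrefl refl)
      ... | tri> _ _ y<x  = contradiction lt (ℕₚ.≤⇒≯ (weak-mono L y<x))

    -- No label lies between `u` and `v`, so raising the last point labelled `u` keeps the labels
    -- weakly increasing. That point then precedes the whole fibre of `v`, and `fibre` is the
    -- monotonicity this requires.
    raise-last : ∀ {x} → label L x ≡ u → (∀ y → label L y ≡ u → y F.≤ x) →
      (∀ {y} → label L y ≡ v → τ x <[ σ v ] τ y) → ∃ (DifferByOne L)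
    raise-last {x} x≡u last fibre = relabel L x v (λ v≡ → v≢u (trans v≡ x≡u))
      (λ y<x → ℕₚ.≤-trans (ℕₚ.≤-trans (weak-mono L y<x) (ℕₚ.≤-reflexive (cong toℕ x≡u))) (ℕₚ.<⇒≤ u<v))
      (λ {y} x<y → subst (_≤ toℕ (label L y)) (sym v≡1+u) (ℕₚ.≤∧≢⇒<
        (subst (F._≤ label L y) x≡u (weak-mono L x<y))
        (λ u≡y → ℕₚ.<⇒≱ x<y (last y (sym (Fₚ.toℕ-injective u≡y))))))
      (λ y<x y≡v → contradiction (label<⇒< (subst₂ F._<_ (sym x≡u) (sym y≡v) u<v)) (ℕₚ.<⇒≯ y<x))
      (λ _ → fibre)

    lower-first : ∀ {x} → label L x ≡ v → (∀ y → label L y ≡ v → x F.≤ y) →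
      (∀ {y} → label L y ≡ u → τ y <[ σ u ] τ x) → ∃ (DifferByOne L)
    lower-first {x} x≡v first fibre = relabel L x u (λ u≡ → v≢u (sym (trans u≡ x≡v)))
      (λ {y} y<x → ℕₚ.≤-pred (subst (suc (toℕ (label L y)) ≤_) v≡1+u (ℕₚ.≤∧≢⇒<
        (subst (label L y F.≤_) x≡v (weak-mono L y<x))
        (λ y≡v → ℕₚ.<⇒≱ y<x (first y (Fₚ.toℕ-injective y≡v))))))
      (λ x<y → ℕₚ.≤-trans (ℕₚ.≤-trans (ℕₚ.<⇒≤ u<v) (ℕₚ.≤-reflexive (cong toℕ (sym x≡v)))) (weak-mono L x<y))
      (λ _ → fibre)
      (λ x<y y≡u → contradiction (label<⇒< (subst₂ F._<_ (sym y≡u) (sym x≡v) u<v)) (ℕₚ.<⇒≯ x<y))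

    -- If σ u ≠ σ v, then τ has a turning point at the border of the two fibres,
    -- and that point fits in either of them.
    move-border : (∀ {x y} → τ x ≡ τ y → x ≡ y) → ∃ (λ x → label L x ≡ u ⊎ label L x ≡ v) →
      (∀ {x y} → label L x ≡ u → label L y ≡ v → σ u ≢ σ v) → ∃ (DifferByOne L)
    move-border τ-inj (x , x≡) turn
      with none-or-greatest (λ y → label L y F.≟ u) | none-or-least (λ y → label L y F.≟ v)
    move-border τ-inj (x , inj₁ x≡u) turn | inj₁ u-empty | inj₁ _ = contradiction x≡u (u-empty x)
    move-border τ-inj (x , inj₂ x≡v) turn | inj₁ _ | inj₁ v-empty = contradiction x≡v (v-empty x)
    -- A point entering an empty fibre has nothing to be compared with.
    ... | inj₁ u-empty | inj₂ (b , b≡v , first) = lower-first b≡v first λ {y} y≡u → contradiction y≡u (u-empty y)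
    ... | inj₂ (a , a≡u , last) | inj₁ v-empty = raise-last a≡u last λ {y} y≡v → contradiction y≡v (v-empty y)
    -- The values τ a and τ b are distinct and the two signs are opposite. If the values compare as
    -- `σ u` demands, `b` extends the fibre of `u`; otherwise `a` extends that of `v`.
    ... | inj₂ (a , a≡u , last) | inj₂ (b , b≡v , first)
      with ≢⇒<[]-of-opposite-signs (turn a≡u b≡v) (λ τa≡τb → v≢u (trans (sym b≡v) (trans (cong (label L) (sym (τ-inj τa≡τb))) a≡u)))
    ...   | inj₁ τa<τb = lower-first b≡v first below-b
      where
      below-b : ∀ {y} → label L y ≡ u → τ y <[ σ u ] τ b
      below-b {y} y≡u with ℕₚ.m≤n⇒m<n∨m≡n (last y y≡u)
      ... | inj₂ y≡a rewrite Fₚ.toℕ-injective y≡a = τa<τb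
      ... | inj₁ y<a = <[]-trans (σ u)
        (subst (λ t → τ y <[ σ t ] τ a) y≡u (fibrewise L y<a (trans y≡u (sym a≡u)))) τa<τb
    ...   | inj₂ τa<τb = raise-last a≡u last above-a
      where
      above-a : ∀ {y} → label L y ≡ v → τ a <[ σ v ] τ y
      above-a {y} y≡v with ℕₚ.m≤n⇒m<n∨m≡n (first y y≡v)
      ... | inj₂ b≡y rewrite sym (Fₚ.toℕ-injective b≡y) = τa<τb
      ... | inj₁ b<y = <[]-trans (σ v) τa<τb
        (subst (λ t → τ b <[ σ t ] τ y) b≡v (fibrewise L b<y (trans b≡v (sym y≡v))))

  -- The segment of `x` is `Used`, and the segment `t` of sign plus is not, so two neighbours differ
  -- in being `Used`. One of them is nonempty, and if both are, then their signs differ.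
  move-some-border : (∀ {x y} → τ x ≡ τ y → x ≡ y) → (L : Labelling σ τ) →
    ∃ (λ x → σ (label L x) ≡ minus) → ∃ (λ t → σ t ≡ plus) → ∃ (DifferByOne L)
  move-some-border τ-inj L (x , σx≡minus) (t , σt≡plus) =
    let u , v , v≡1+u , change = adjacent-change Used? {label L x} {t} (σx≡minus , x , refl)
          (λ { (σt≡minus , _) → contradiction (trans (sym σt≡plus) σt≡minus) λ () })
    in move-border L v≡1+u τ-inj (nonempty change) (turn change)
    where
    Used : Fin k → Set
    Used t = σ t ≡ minus × ∃ λ y → label L y ≡ t
    Used? : Decidable Used
    Used? t = (σ t ≟ˢ minus) ×-dec Fₚ.any? λ y → label L y F.≟ t
    nonempty : ∀ {u v} → (Used u × ¬ Used v) ⊎ (¬ Used u × Used v) → ∃ λ x → label L x ≡ u ⊎ label L x ≡ v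
    nonempty (inj₁ ((_ , y , y≡u) , _)) = y , inj₁ y≡u
    nonempty (inj₂ (_ , (_ , y , y≡v))) = y , inj₂ y≡v
    turn : ∀ {u v} → (Used u × ¬ Used v) ⊎ (¬ Used u × Used v) →
      ∀ {x y} → label L x ≡ u → label L y ≡ v → σ u ≢ σ v
    turn (inj₁ ((σu , _) , ¬v)) x≡u y≡v σu≡σv = ¬v (trans (sym σu≡σv) σu , _ , y≡v)
    turn (inj₂ (¬u , (σv , _))) x≡u y≡v σu≡σv = ¬u (trans σu≡σv σv , _ , x≡u)

-- Periodic words

Period : ∀ {k} → Word k → ℕ → Set
Period s d = ∀ i → s (i + d) ≡ s i

Period-multiple : ∀ {k} {s : Word k} {d} → Period s d → ∀ i c → s (i + c * d) ≡ s i
Period-multiple {s = s} per i zero = cong s (ℕₚ.+-identityʳ i)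
Period-multiple {s = s} {d} per i (suc c) =
  trans (cong s (trans (cong (i +_) (ℕₚ.+-comm d (c * d))) (sym (ℕₚ.+-assoc i (c * d) d))))
  (trans (per (i + c * d)) (Period-multiple per i c))

Period-% : ∀ {k} {s : Word k} {d} .{{_ : ℕ.NonZero d}} → Period s d → ∀ i → s i ≡ s (i % d)
Period-% {s = s} {d} per i = trans (cong s (m≡m%n+[m/n]*n i d)) (Period-multiple per (i % d) (i ℕ./ d))

Period-cong-% : ∀ {k} {s : Word k} {d} .{{_ : ℕ.NonZero d}} → Period s d → ∀ {a b} → a % d ≡ b % d → s a ≡ s b
Period-cong-% {s = s} per {a} {b} eq = trans (Period-% per a) (trans (cong s eq) (sym (Period-% per b)))

-- Passes from the finite word in `Primitive` to the infinite one: reduce an index modulo `n`, then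
-- modulo `d` inside the window. Since `d` divides `n`, this is reduction modulo `d`.
Period-from-window : ∀ {k} {s : Word k} {n d} .{{_ : ℕ.NonZero n}} .{{_ : ℕ.NonZero d}} → Period s n → d ∣ n →
  (∀ i → i + d ℕ.< n → s (i + d) ≡ s i) → Period s d
Period-from-window {s = s} {n} {d} per d∣n window i =
  trans (reduce (i + d)) (trans (cong s ([m+n]%n≡m%n i d)) (sym (reduce i)))
  where
  multiple : ∀ r c → r + c * d ℕ.< n → s (r + c * d) ≡ s r
  multiple r zero    _  = cong s (ℕₚ.+-identityʳ r)
  multiple r (suc c) lt =
    trans (cong s eq) (trans (window (r + c * d) lt′) (multiple r c (ℕₚ.≤-<-trans (ℕₚ.m≤m+n _ d) lt′)))
    where
    eq : r + suc c * d ≡ r + c * d + d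
    eq = trans (cong (r +_) (ℕₚ.+-comm d (c * d))) (sym (ℕₚ.+-assoc r (c * d) d))
    lt′ : r + c * d + d ℕ.< n
    lt′ = subst (ℕ._< n) eq lt
  reduce< : ∀ i → i ℕ.< n → s i ≡ s (i % d)
  reduce< i i<n = trans (cong s (m≡m%n+[m/n]*n i d))
    (multiple (i % d) (i ℕ./ d) (subst (ℕ._< n) (m≡m%n+[m/n]*n i d) i<n))
  reduce : ∀ i → s i ≡ s (i % d)
  reduce i = trans (Period-% per i) (trans (reduce< (i % n) (m%n<n i n)) (cong s (m∣n⇒o%n%m≡o%m d n i d∣n)))

double-injective : ∀ {u v} → u + u ≡ v + v → u ≡ v
double-injective {u} {v} eq with ℕₚ.<-cmp u v
... | tri< u<v _ _ = contradiction eq (ℕₚ.<⇒≢ (ℕₚ.+-mono-< u<v u<v))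
... | tri≈ _ u≡v _ = u≡v
... | tri> _ _ v<u = contradiction (sym eq) (ℕₚ.<⇒≢ (ℕₚ.+-mono-< v<u v<u))

-- Here 2d is a multiple of `n` strictly between 0 and 2n.
half-if-double-vanishes : ∀ {n d} .{{_ : ℕ.NonZero n}} → 0 ℕ.< d → d ℕ.< n → (d + d) % n ≡ 0 → d + d ≡ n
half-if-double-vanishes {n} {d} 0<d d<n eq with (d + d) ℕ.<? n
... | yes 2d<n = contradiction (trans (sym (m<n⇒m%n≡m 2d<n)) eq)
  (λ 2d≡0 → ℕₚ.<-irrefl (sym (ℕₚ.m+n≡0⇒m≡0 d 2d≡0)) 0<d)
... | no 2d≮n = trans (sym r+n≡2d) (cong (_+ n) r≡0)
  where
  r = d + d ∸ n
  r+n≡2d : r + n ≡ d + d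
  r+n≡2d = ℕₚ.m∸n+n≡m (ℕₚ.≮⇒≥ 2d≮n)
  r<n : r ℕ.< n
  r<n = ℕₚ.+-cancelʳ-< n r n (subst (ℕ._< n + n) (sym r+n≡2d) (ℕₚ.+-mono-< d<n d<n))
  r≡0 : r ≡ 0
  r≡0 = trans (sym (m<n⇒m%n≡m r<n)) (trans (sym ([m+n]%n≡m%n r n)) (trans (cong (_% n) r+n≡2d) eq))

-- The cycle of `hat π`

module Orbit {n′} (π : Permutation′ (suc n′)) where

  private
    n = suc n′

    index : ℕ → Fin n
    index m = fromℕ< (m%n<n m n)

    index-cong : ∀ {a b} → a % n ≡ b % n → index a ≡ index b
    index-cong {a} {b} eq = Fₚ.fromℕ<-cong (a % n) (b % n) eq (m%n<n a n) (m%n<n b n)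

    toℕ-index : ∀ m → toℕ (index m) ≡ m % n
    toℕ-index m = Fₚ.toℕ-fromℕ< (m%n<n m n)

  -- The one-line notation of `π` continued periodically, so that `hat π` becomes the successor on
  -- indices.
  orbit : ℕ → Fin n
  orbit m = π ⟨$⟩ʳ index m

  orbit-cong : ∀ {a b} → a % n ≡ b % n → orbit a ≡ orbit b
  orbit-cong {a} {b} eq = cong (π ⟨$⟩ʳ_) (index-cong {a} {b} eq)

  orbit-injective : ∀ {a b} → orbit a ≡ orbit b → a % n ≡ b % n
  orbit-injective {a} {b} eq = trans (sym (toℕ-index a)) (trans (cong toℕ index≡) (toℕ-index b))
    where
    index≡ : index a ≡ index b
    index≡ = trans (sym (inverseˡ π)) (trans (cong (π ⟨$⟩ˡ_) eq) (inverseˡ π))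

  orbit-+n : ∀ m → orbit (m + n) ≡ orbit m
  orbit-+n m = orbit-cong {m + n} {m} ([m+n]%n≡m%n m n)

  orbit-toℕ : ∀ i → orbit (toℕ i) ≡ π ⟨$⟩ʳ i
  orbit-toℕ i = cong (π ⟨$⟩ʳ_) (Fₚ.toℕ-injective (trans (toℕ-index (toℕ i)) (m<n⇒m%n≡m (Fₚ.toℕ<n i))))

  orbit-surjective : ∀ x → ∃ λ m → orbit m ≡ x
  orbit-surjective x = toℕ (π ⟨$⟩ˡ x) , trans (orbit-toℕ _) (inverseʳ π)

  suc-% : ∀ m → suc (m % n) % n ≡ suc m % n
  suc-% m = begin
    (1 + m % n) % n           ≡⟨ %-distribˡ-+ 1 (m % n) n ⟩
    (1 % n + m % n % n) % n   ≡⟨ cong (λ r → (1 % n + r) % n) (m%n%n≡m%n m n) ⟩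
    (1 % n + m % n) % n       ≡⟨ sym (%-distribˡ-+ 1 m n) ⟩
    (1 + m) % n               ∎
    where open ≡-Reasoning

  hat-orbit : ∀ m → hat π (orbit m) ≡ orbit (suc m)
  hat-orbit m = trans (cong (λ i → π ⟨$⟩ʳ nextIdx i) (inverseˡ π))
    (orbit-cong {suc (toℕ (index m))} {suc m} (trans (cong (λ r → suc r % n) (toℕ-index m)) (suc-% m)))

  iter-hat-orbit : ∀ m a → iter (hat π) m (orbit a) ≡ orbit (m + a)
  iter-hat-orbit zero    a = refl
  iter-hat-orbit (suc m) a = trans (cong (hat π) (iter-hat-orbit m a)) (hat-orbit (m + a))

  -- Going back `a` steps on a cycle of length `n` amounts to going forward `a * n′` steps, because
  -- a + a * n′ = a * n. This moves the coincidence to index 0.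
  orbit-return : ∀ a D → orbit (a + D) ≡ orbit a → D % n ≡ 0
  orbit-return a D eq = orbit-injective {D} {0} (begin
    orbit D                                 ≡⟨ unwind D ⟨
    orbit (a * n′ + (a + D))                ≡⟨ iter-hat-orbit (a * n′) (a + D) ⟨
    iter (hat π) (a * n′) (orbit (a + D))   ≡⟨ cong (iter (hat π) (a * n′)) eq ⟩
    iter (hat π) (a * n′) (orbit a)         ≡⟨ cong (iter (hat π) (a * n′) ∘ orbit) (ℕₚ.+-identityʳ a) ⟨
    iter (hat π) (a * n′) (orbit (a + 0))   ≡⟨ iter-hat-orbit (a * n′) (a + 0) ⟩
    orbit (a * n′ + (a + 0))                ≡⟨ unwind 0 ⟩
    orbit 0                                 ∎)
    where
    open ≡-Reasoning
    unwind : ∀ m → orbit (a * n′ + (a + m)) ≡ orbit m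
    unwind m = orbit-cong {a * n′ + (a + m)} {m} (trans (cong (_% n) (begin
      a * n′ + (a + m)   ≡⟨ ℕₚ.+-assoc (a * n′) a m ⟨
      a * n′ + a + m     ≡⟨ cong (_+ m) (ℕₚ.+-comm (a * n′) a) ⟩
      a + a * n′ + m     ≡⟨ cong (_+ m) (ℕₚ.*-suc a n′) ⟨
      a * n + m          ≡⟨ ℕₚ.+-comm (a * n) m ⟩
      m + a * n          ∎)) ([m+kn]%n≡m%n m a n))

  -- The remaining n - 1 steps around the cycle undo `hat π`, which makes it injective.
  iter-n′-hat : ∀ x → iter (hat π) n′ (hat π x) ≡ x
  iter-n′-hat x with orbit-surjective x
  ... | a , refl = begin
    iter (hat π) n′ (hat π (orbit a)) ≡⟨ cong (iter (hat π) n′) (hat-orbit a) ⟩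
    iter (hat π) n′ (orbit (suc a))   ≡⟨ iter-hat-orbit n′ (suc a) ⟩
    orbit (n′ + suc a)                ≡⟨ cong orbit (trans (ℕₚ.+-suc n′ a) (ℕₚ.+-comm n a)) ⟩
    orbit (a + n)                     ≡⟨ orbit-+n a ⟩
    orbit a                           ∎
    where open ≡-Reasoning

  hat-injective : ∀ {x y} → hat π x ≡ hat π y → x ≡ y
  hat-injective {x} {y} eq = trans (sym (iter-n′-hat x)) (trans (cong (iter (hat π) n′) eq) (iter-n′-hat y))

  hat-surjective : ∀ y → ∃ λ x → hat π x ≡ y
  hat-surjective y with orbit-surjective y
  ... | a , refl = orbit (a + n′) , trans (hat-orbit (a + n′)) (trans (cong orbit (sym (ℕₚ.+-suc a n′))) (orbit-+n a))

  hat-bijective : Bijective _≡_ _≡_ (hat π)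
  hat-bijective = hat-injective , λ y → proj₁ (hat-surjective y) , λ { refl → proj₂ (hat-surjective y) }

  hat-singleCycle : SingleCycle (hat π)
  hat-singleCycle x y with orbit-surjective y
  -- From index `i`, the first `n ∸ toℕ i` steps complete the turn to index 0 modulo `n`, and `b`
  -- more reach `y`.
  ... | b , refl = b + (n ∸ toℕ i) , (begin
    iter (hat π) (b + (n ∸ toℕ i)) x                ≡⟨ cong (iter (hat π) (b + (n ∸ toℕ i))) (sym (trans (orbit-toℕ i) (inverseʳ π))) ⟩
    iter (hat π) (b + (n ∸ toℕ i)) (orbit (toℕ i))  ≡⟨ iter-hat-orbit (b + (n ∸ toℕ i)) (toℕ i) ⟩
    orbit (b + (n ∸ toℕ i) + toℕ i)                 ≡⟨ cong orbit (trans (ℕₚ.+-assoc b _ _) (cong (b +_) (ℕₚ.m∸n+n≡m (ℕₚ.<⇒≤ (Fₚ.toℕ<n i))))) ⟩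
    orbit (b + n)                                   ≡⟨ orbit-+n b ⟩
    orbit b                                         ∎)
    where
    open ≡-Reasoning
    i = π ⟨$⟩ˡ x

  -- From patterns to labellings

  module _ {k} {σ : Fin k → Sign} where

    -- The suffix attached to a point `x` starts at the position where `π` takes the value `x`, so
    -- suffixes increase with `x`. Their heads give `weak-mono`; their tails, attached to `hat π x`,
    -- give `fibrewise`.
    pattern⇒Labelling : ∀ {s} → Period s n → IsPattern σ s π → Labelling σ (hat π)
    pattern⇒Labelling {s} per pat = record
      { label     = λ x → s (toℕ (π ⟨$⟩ˡ x))
      ; weak-mono = λ x<y → subst₂ F._≤_ (head _) (head _) (SignedPrec⇒head≤ σ (prec x<y))
      ; fibrewise = fibre
      }
      where
      suffix : Fin n → Word k
      suffix x = shift s (toℕ (π ⟨$⟩ˡ x))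
      head : ∀ x → suffix x 0 ≡ s (toℕ (π ⟨$⟩ˡ x))
      head x = cong s (ℕₚ.+-identityʳ _)
      prec : ∀ {x y} → x F.< y → SignedPrec σ (suffix x) (suffix y)
      prec x<y = Prec⇒SignedPrec σ (Equivalence.to (pat _ _) (subst₂ F._<_ (sym (inverseʳ π)) (sym (inverseʳ π)) x<y))
      tail≗ : ∀ (i : Fin n) m → shift (shift s (toℕ i)) 1 m ≡ shift s (toℕ (nextIdx i)) m
      tail≗ i m = Period-cong-% {s = s} per {toℕ i + suc m} {toℕ (nextIdx i) + m} (begin
        (toℕ i + suc m) % n                 ≡⟨ cong (_% n) (ℕₚ.+-suc (toℕ i) m) ⟩
        (suc (toℕ i) + m) % n               ≡⟨ %-distribˡ-+ (suc (toℕ i)) m n ⟩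
        (suc (toℕ i) % n + m % n) % n       ≡⟨ cong (λ r → (r + m % n) % n) (sym (m%n%n≡m%n (suc (toℕ i)) n)) ⟩
        (suc (toℕ i) % n % n + m % n) % n   ≡⟨ sym (%-distribˡ-+ (suc (toℕ i) % n) m n) ⟩
        (suc (toℕ i) % n + m) % n           ≡⟨ cong (λ r → (r + m) % n) (sym (toℕ-index (suc (toℕ i)))) ⟩
        (toℕ (nextIdx i) + m) % n           ∎)
        where open ≡-Reasoning
      hat< : ∀ {x y} → SignedPrec σ (shift (suffix x) 1) (shift (suffix y) 1) → hat π x F.< hat π y
      hat< {x} {y} tail-prec = Equivalence.from (pat _ _) (SignedPrec⇒Prec σ
        (SignedPrec-resp-≗ σ (tail≗ (π ⟨$⟩ˡ x)) (tail≗ (π ⟨$⟩ˡ y)) tail-prec))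
      fibre : ∀ {x y} → x F.< y → s (toℕ (π ⟨$⟩ˡ x)) ≡ s (toℕ (π ⟨$⟩ˡ y)) → hat π x <[ σ (s (toℕ (π ⟨$⟩ˡ x))) ] hat π y
      fibre {x} {y} x<y eq with σ (s (toℕ (π ⟨$⟩ˡ x))) in σ≡
      ... | plus  = hat< {x} {y} (SignedPrec-tail-plus σ (trans (head x) (trans eq (sym (head y)))) (trans (cong σ (head x)) σ≡) (prec x<y))
      ... | minus = hat< {y} {x} (SignedPrec-tail-minus σ (trans (head x) (trans eq (sym (head y)))) (trans (cong σ (head x)) σ≡) (prec x<y))

    -- Itineraries of a labelling

    module Itinerary (L : Labelling σ (hat π)) where

      open Labelling L

      itinerary : Word k
      itinerary m = label (orbit m)

      itinerary-period : Period itinerary n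
      itinerary-period i = cong label (orbit-+n i)

      hat-<[] : ∀ δ {x y} → label x ≡ label y → x <[ δ ] y → hat π x <[ δ · σ (label x) ] hat π y
      hat-<[] plus  eq x<y = fibrewise x<y eq
      hat-<[] minus {x} {y} eq y<x = <[]-flip⁻ (σ (label x))
        (subst (λ t → hat π y <[ σ t ] hat π x) (sym eq) (fibrewise y<x (sym eq)))

      -- As long as two orbits share a segment, each step multiplies the direction of comparison by
      -- the sign of that segment.
      orbit-<[] : ∀ δ a b m → (∀ i → i ℕ.< m → itinerary (a + i) ≡ itinerary (b + i)) →
        orbit a <[ δ ] orbit b → orbit (a + m) <[ δ · prefixSign σ (shift itinerary a) m ] orbit (b + m)
      orbit-<[] δ a b zero agree lt
        rewrite ℕₚ.+-identityʳ a | ℕₚ.+-identityʳ b | ·-identityʳ δ = lt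
      orbit-<[] δ a b (suc m) agree lt
        rewrite ℕₚ.+-suc a m | ℕₚ.+-suc b m
              | sym (hat-orbit (a + m)) | sym (hat-orbit (b + m))
              | sym (·-assoc δ (prefixSign σ (shift itinerary a) m) (σ (itinerary (a + m)))) =
        hat-<[] _ (agree m ℕₚ.≤-refl) (orbit-<[] δ a b m (λ i i<m → agree i (ℕₚ.m<n⇒m<1+n i<m)) lt)

      -- The D-th power of hat π preserves order among points with the same itinerary, so a
      -- D-step along the orbit that moved up (or down) would do so forever.
      positive-period : ∀ D → Period itinerary D → prefixSign σ itinerary D ≡ plus → D % n ≡ 0
      positive-period D per sign≡ with D % n ℕ.≟ 0
      ... | yes D%n≡0 = D%n≡0
      ... | no  D%n≢0 = contradiction (climb n′) no-climb
        where
        start : ∃ λ ε → orbit 0 <[ ε ] orbit D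
        start = ≢⇒<[] λ eq → D%n≢0 (sym (orbit-injective {0} {D} eq))
        ε = proj₁ start
        multiple-sign : ∀ m → prefixSign σ itinerary (m * D) ≡ plus
        multiple-sign zero    = refl
        multiple-sign (suc m) = trans (prefixSign-+ σ itinerary D (m * D))
          (trans (cong (_· prefixSign σ (shift itinerary D) (m * D)) sign≡) (trans
            (prefixSign-cong σ (m * D) λ i _ → trans (cong itinerary (ℕₚ.+-comm D i)) (per i)) (multiple-sign m)))
        step : ∀ m → orbit (m * D) <[ ε ] orbit (D + m * D)
        step m = subst (orbit (m * D) <[_] orbit (D + m * D))
          (trans (cong (ε ·_) (multiple-sign m)) (·-identityʳ ε))
          (orbit-<[] ε 0 D (m * D) (λ i _ → sym (trans (cong itinerary (ℕₚ.+-comm D i)) (per i))) (proj₂ start))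
        climb : ∀ m → orbit 0 <[ ε ] orbit (suc m * D)
        climb zero    = step 0
        climb (suc m) = <[]-trans ε (climb m) (step (suc m))
        -- After `n` jumps of length `D` the orbit is back at its start.
        no-climb : ¬ orbit 0 <[ ε ] orbit (n * D)
        no-climb lt = <[]-irrefl ε (subst (orbit 0 <[ ε ]_)
          (orbit-cong {n * D} {0} (trans (cong (_% n) (ℕₚ.*-comm n D)) ([m+kn]%n≡m%n 0 D n))) lt)

      -- The sign over two periods is a square, hence plus, so `positive-period` applies to 2d.
      period⇒half : ∀ {d} → 0 ℕ.< d → d ℕ.< n → Period itinerary d → d + d ≡ n
      period⇒half {d} 0<d d<n per = half-if-double-vanishes 0<d d<n (positive-period (d + d)
        (λ i → trans (cong itinerary (sym (ℕₚ.+-assoc i d d))) (trans (per (i + d)) (per i)))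
        (trans (prefixSign-+ σ itinerary d d) (trans
          (cong (prefixSign σ itinerary d ·_)
            (prefixSign-cong σ d λ i _ → trans (cong itinerary (ℕₚ.+-comm d i)) (per i)))
          (·-self (prefixSign σ itinerary d)))))

      -- With sign plus over one period, `n` would divide `d`, although 0 < d < n. So the sign is
      -- minus, and some letter contributes it.
      period⇒minus : ∀ {d} → 0 ℕ.< d → d ℕ.< n → Period itinerary d → ∃ λ x → σ (label x) ≡ minus
      period⇒minus {d} 0<d d<n per with prefixSign σ itinerary d in sign≡
      ... | plus  = contradiction 0<d (ℕₚ.<-irrefl (sym (trans (sym (m<n⇒m%n≡m d<n)) (positive-period d per sign≡))))
      ... | minus = let i , σi≡minus = prefixSign-minus⇒minus σ itinerary d sign≡ in orbit i , σi≡minus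

      -- All lengths below `n` are excluded, not just divisors: equality of two suffixes yields the
      -- difference of their positions as a period.
      Aperiodic : Set
      Aperiodic = ∀ d → 0 ℕ.< d → d ℕ.< n → ¬ Period itinerary d

      aperiodic⇒primitive : Aperiodic → Primitive n itinerary
      aperiodic⇒primitive aper (suc d , 0<d , d<n , d∣n , window) =
        aper (suc d) 0<d d<n (Period-from-window itinerary-period d∣n window)

      label-order : ∀ δ {x y} → x <[ δ ] y → ¬ label y <[ δ ] label x
      label-order plus  x<y = ℕₚ.≤⇒≯ (weak-mono x<y)
      label-order minus y<x = ℕₚ.≤⇒≯ (weak-mono y<x)

      -- Agreement on `n` letters extends to all letters by periodicity, and then `b ∸ a` is a
      -- period. Index `i` is replaced by `i + n` so that it lies beyond `a`.
      aperiodic⇒suffixes-differ : Aperiodic → ∀ {a b} → a ℕ.< b → b ℕ.< n →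
        ¬ (∀ m → m ℕ.< n → itinerary (a + m) ≡ itinerary (b + m))
      aperiodic⇒suffixes-differ aper {a} {b} a<b b<n agree =
        aper (b ∸ a) (ℕₚ.m<n⇒0<n∸m a<b) (ℕₚ.≤-<-trans (ℕₚ.m∸n≤m b a) b<n) λ i → sym (begin
          itinerary i                            ≡⟨ sym (itinerary-period i) ⟩
          itinerary (i + n)                      ≡⟨ cong itinerary (back i) ⟩
          itinerary (a + (n ∸ a + i))            ≡⟨ agree-all (n ∸ a + i) ⟩
          itinerary (b + (n ∸ a + i))            ≡⟨ cong itinerary (forth i) ⟩
          itinerary (i + (b ∸ a) + n)            ≡⟨ itinerary-period (i + (b ∸ a)) ⟩
          itinerary (i + (b ∸ a))                ∎)
        where
        open ≡-Reasoning
        back : ∀ i → i + n ≡ a + (n ∸ a + i)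
        back i = trans (ℕₚ.+-comm i n) (trans (cong (_+ i) (sym (ℕₚ.m+[n∸m]≡n (ℕₚ.<⇒≤ (ℕₚ.<-trans a<b b<n))))) (ℕₚ.+-assoc a _ i))
        forth : ∀ i → b + (n ∸ a + i) ≡ i + (b ∸ a) + n
        forth i = begin
          b + (n ∸ a + i)               ≡⟨ cong (_+ (n ∸ a + i)) (sym (ℕₚ.m∸n+n≡m (ℕₚ.<⇒≤ a<b))) ⟩
          b ∸ a + a + (n ∸ a + i)       ≡⟨ ℕₚ.+-assoc (b ∸ a) a _ ⟩
          b ∸ a + (a + (n ∸ a + i))     ≡⟨ cong (b ∸ a +_) (sym (back i)) ⟩
          b ∸ a + (i + n)               ≡⟨ sym (ℕₚ.+-assoc (b ∸ a) i n) ⟩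
          b ∸ a + i + n                 ≡⟨ cong (_+ n) (ℕₚ.+-comm (b ∸ a) i) ⟩
          i + (b ∸ a) + n               ∎
        shift-period : ∀ c m → itinerary (c + m) ≡ itinerary (c + m % n)
        shift-period c = Period-% {s = shift itinerary c}
          λ i → trans (cong itinerary (sym (ℕₚ.+-assoc c i n))) (itinerary-period (c + i))
        agree-all : ∀ m → itinerary (a + m) ≡ itinerary (b + m)
        agree-all m = trans (shift-period a m) (trans (agree (m % n) (m%n<n m n)) (sym (shift-period b m)))

      -- The order of two orbit points is carried, with the prefix sign, to the first index where
      -- the labels differ; there `weak-mono` passes it on to the labels.
      aperiodic⇒pattern : Aperiodic → IsPattern σ itinerary π
      aperiodic⇒pattern aper i j = mk⇔ to from
        where
        a = toℕ i
        b = toℕ j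
        separated : ¬ i ≡ j → ¬ (∀ m → m ℕ.< n → itinerary (a + m) ≡ itinerary (b + m))
        separated i≢j agree with Fₚ.<-cmp i j
        ... | tri< i<j _ _ = aperiodic⇒suffixes-differ aper i<j (Fₚ.toℕ<n j) agree
        ... | tri≈ _ i≡j _ = i≢j i≡j
        ... | tri> _ _ j<i = aperiodic⇒suffixes-differ aper j<i (Fₚ.toℕ<n i) λ m m<n → sym (agree m m<n)
        to : (π ⟨$⟩ʳ i) F.< (π ⟨$⟩ʳ j) → Prec σ (shift itinerary a) (shift itinerary b)
        to πi<πj with all-or-first-failure (λ m → itinerary (a + m) F.≟ itinerary (b + m)) n
        ... | inj₁ agree = contradiction agree (separated λ { refl → ℕₚ.<-irrefl refl πi<πj })
        ... | inj₂ (m , agree , differ) = SignedPrec⇒Prec σ (m , agree , first-difference (≢⇒<[]-of-opposite-signs (ε≢minus·ε ε) differ))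
          where
          ε = prefixSign σ (shift itinerary a) m
          ε≢minus·ε : ∀ ε → ε ≢ minus · ε
          ε≢minus·ε plus  ()
          ε≢minus·ε minus ()
          moved : orbit (a + m) <[ ε ] orbit (b + m)
          moved = orbit-<[] plus a b m agree (subst₂ F._<_ (sym (orbit-toℕ i)) (sym (orbit-toℕ j)) πi<πj)
          first-difference : itinerary (a + m) <[ ε ] itinerary (b + m) ⊎ itinerary (a + m) <[ minus · ε ] itinerary (b + m) →
            itinerary (a + m) <[ ε ] itinerary (b + m)
          first-difference (inj₁ lt) = lt
          first-difference (inj₂ gt) = contradiction (<[]-flip ε gt) (label-order ε moved)
        from : Prec σ (shift itinerary a) (shift itinerary b) → (π ⟨$⟩ʳ i) F.< (π ⟨$⟩ʳ j)
        from prec with Prec⇒SignedPrec σ prec | Fₚ.<-cmp (π ⟨$⟩ʳ i) (π ⟨$⟩ʳ j)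
        ... | _ | tri< πi<πj _ _ = πi<πj
        ... | m , agree , lt | tri≈ _ πi≡πj _ =
          contradiction (subst (λ c → itinerary (a + m) <[ _ ] itinerary (toℕ c + m)) (sym i≡j) lt) (<[]-irrefl _)
          where
          i≡j : i ≡ j
          i≡j = trans (sym (inverseˡ π)) (trans (cong (π ⟨$⟩ˡ_) πi≡πj) (inverseˡ π))
        -- The opposite order of `π` would be carried to index `m` and reverse the labels there. The
        -- prefix signs of both suffixes coincide.
        ... | m , agree , lt | tri> _ _ πj<πi =
          contradiction (subst (itinerary (a + m) <[_] itinerary (b + m)) (prefixSign-cong σ m agree) lt) (label-order _ moved)
          where
          moved : orbit (b + m) <[ prefixSign σ (shift itinerary b) m ] orbit (a + m)
          moved = orbit-<[] plus b a m (λ i i<m → sym (agree i i<m)) (subst₂ F._<_ (sym (orbit-toℕ j)) (sym (orbit-toℕ i)) πj<πi)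

    -- Obtaining a primitive itinerary

    open Itinerary

    -- A period of the new itinerary must again be n / 2 = D, but x and its D-th iterate under
    -- hat π, which had equal labels, no longer do.
    differ-by-one⇒aperiodic : ∀ {L L′ D} → 0 ℕ.< D → D ℕ.< n → Period (itinerary L) D → DifferByOne L L′ → Aperiodic L′
    differ-by-one⇒aperiodic {L} {L′} {D} 0<D D<n per (x , changed , unchanged) d 0<d d<n per′ with orbit-surjective x
    ... | a , refl = changed (begin
      itinerary L′ a         ≡⟨ per′ a ⟨
      itinerary L′ (a + d)   ≡⟨ cong (λ e → itinerary L′ (a + e)) d≡D ⟩
      itinerary L′ (a + D)   ≡⟨ unchanged (orbit (a + D)) partner≢x ⟩
      itinerary L (a + D)    ≡⟨ per a ⟩
      itinerary L a          ∎)
      where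
      open ≡-Reasoning
      d≡D : d ≡ D
      d≡D = double-injective (trans (period⇒half L′ 0<d d<n per′) (sym (period⇒half L 0<D D<n per)))
      partner≢x : orbit (a + D) ≢ orbit a
      partner≢x eq = ℕₚ.<-irrefl (sym (trans (sym (m<n⇒m%n≡m D<n)) (orbit-return a D eq))) 0<D

    -- Both sides of the equation are `n`-periodic in `i`, so checking `n` indices decides it.
    period? : ∀ L d → Dec (Period (itinerary L) d)
    period? L d = map′ extend (λ per → per ∘ toℕ)
      (Fₚ.all? λ (i : Fin n) → itinerary L (toℕ i + d) F.≟ itinerary L (toℕ i))
      where
      open ≡-Reasoning
      shifted : Period (shift (itinerary L) d) n
      shifted i = trans (cong (itinerary L) (sym (ℕₚ.+-assoc d i n))) (itinerary-period L (d + i))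
      extend : (∀ (i : Fin n) → itinerary L (toℕ i + d) ≡ itinerary L (toℕ i)) → Period (itinerary L) d
      extend window i = begin
        itinerary L (i + d)         ≡⟨ cong (itinerary L) (ℕₚ.+-comm i d) ⟩
        itinerary L (d + i)         ≡⟨ Period-% {s = shift (itinerary L) d} shifted i ⟩
        itinerary L (d + i % n)     ≡⟨ cong (itinerary L) (ℕₚ.+-comm d (i % n)) ⟩
        itinerary L (i % n + d)     ≡⟨ subst (λ j → itinerary L (j + d) ≡ itinerary L j) (toℕ-index i) (window (index i)) ⟩
        itinerary L (i % n)         ≡⟨ Period-% {s = itinerary L} (itinerary-period L) i ⟨
        itinerary L i               ∎

    aperiodic-labelling : ∃ (λ t → σ t ≡ plus) → Labelling σ (hat π) → ∃ Aperiodic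
    -- The search runs through 0 < d < n; zero is a period of every word and has to be left out.
    aperiodic-labelling some-plus L = by-cases (Fₚ.any? λ (d : Fin n) → (0 ℕ.<? toℕ d) ×-dec period? L (toℕ d))
      where
      by-cases : Dec (∃ λ (d : Fin n) → 0 ℕ.< toℕ d × Period (itinerary L) (toℕ d)) → ∃ Aperiodic
      by-cases (no none) = L , λ d 0<d d<n per → none (fromℕ< d<n ,
        subst (λ e → 0 ℕ.< e × Period (itinerary L) e) (sym (Fₚ.toℕ-fromℕ< d<n)) (0<d , per))
      by-cases (yes (d , 0<d , per)) =
        let L′ , L~L′ = move-some-border hat-injective L (period⇒minus L 0<d (Fₚ.toℕ<n d) per) some-plus
        in L′ , differ-by-one⇒aperiodic {L} {L′} 0<d (Fₚ.toℕ<n d) per L~L′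

    InP⇒InC : InP σ π → InC σ (hat π)
    InP⇒InC (s , (per , _) , pat) = hat-bijective , hat-singleCycle , Labelling⇒InS (pattern⇒Labelling per pat)

    InC⇒InP : ∃ (λ t → σ t ≡ plus) → InC σ (hat π) → InP σ π
    InC⇒InP some-plus (_ , _ , inS) =
      let L , aper = aperiodic-labelling some-plus (InS⇒Labelling inS)
      in itinerary L , (itinerary-period L , aperiodic⇒primitive L aper) , aperiodic⇒pattern L aper

theorem2p1 : (k : ℕ) → 2 ≤ k → (σ : Fin k → Sign) → ¬ (∀ t → σ t ≡ minus)
    → (n : ℕ) → 1 ≤ n → (π : Permutation′ n)
    → InP σ π ⇔ InC σ (hat π)
theorem2p1 k _ σ σ≢minus (suc n′) _ π = mk⇔ InP⇒InC (InC⇒InP some-plus)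
  where
  open Orbit π
  some-plus : ∃ λ t → σ t ≡ plus
  some-plus = let t , σt≢minus = Fₚ.¬∀⟶∃¬ k (λ t → σ t ≡ minus) (λ t → σ t ≟ˢ minus) σ≢minus
              in t , ≢minus⇒plus σt≢minus
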